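{- Let $G=(V,E)$ be an atomic bispanning graph and $v\in V$ a vertex of degree $3$ with adjacent vertices $x,y,z$ and incident edges $e_x,e_y,e_z$ (joining $v$ to $x,y,z$ respectively). For each $\{a,b,c\}=\{x,y,z\}$, let $G_{a,b}$ be the graph obtained from $G$ by deleting $v$ (with $e_x,e_y,e_z$) and adding a new edge $e_{a,b}$ joining $a$ and $b$ (equivalently, $G/e_a-e_c$). Then $G_{x,y}$, $G_{x,z}$ and $G_{y,z}$ are all bispanning.
   Context: Graphs are finite, undirected, may have parallel edges, no loops. A graph is bispanning if its edge set is the disjoint union of two spanning trees. A bispanning graph is atomic if it contains no subgraph that is itself bispanning other than $G$ and the single-vertex graph $K_1$ (atomic bispanning graphs are simple). -}

module Defs where

open import Data.Nat using (ℕ)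
open import Data.Fin using (Fin)
open import Data.Fin.Subset using (Subset; _∈_; _⊆_; _─_; ⊤; Nonempty; ∣_∣)
open import Data.Product using (_×_; _,_; proj₁; proj₂; Σ; ∃)
open import Data.Sum using (_⊎_)
open import Data.List using (List; []; _∷_)
open import Data.List.Relation.Unary.Unique.Propositional using (Unique)
open import Relation.Binary.PropositionalEquality using (_≡_; _≢_)

-- A finite multigraph with vertex set Fin n and edge set Fin m; edge e has
-- endpoints ends e.  Parallel edges are allowed (distinct edge indices with the
-- same endpoints).  Looplessness is a separate hypothesis.
record Graph (n m : ℕ) : Set where
  field
    ends : Fin m → Fin n × Fin n
open Graph public

module _ {n m : ℕ} (G : Graph n m) where

  Joins : Fin m → Fin n → Fin n → Set
  Joins e u w = ends G e ≡ (u , w) ⊎ ends G e ≡ (w , u)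

  Incident : Fin m → Fin n → Set
  Incident e v = proj₁ (ends G e) ≡ v ⊎ proj₂ (ends G e) ≡ v

  Loopless : Set
  Loopless = ∀ e → proj₁ (ends G e) ≢ proj₂ (ends G e)

  data Walk (S : Subset m) : Fin n → Fin n → List (Fin m) → Set where
    here : ∀ {u} → Walk S u u []
    step : ∀ {u w t e es} → e ∈ S → Joins e u w → Walk S w t es →
           Walk S u t (e ∷ es)

  Acyclic : Subset m → Set
  Acyclic S = ∀ u es → Walk S u u es → Unique es → es ≡ []

  SpanningTreeOn : Subset n → Subset m → Set
  SpanningTreeOn W S =
    (∀ u w → u ∈ W → w ∈ W → ∃ λ es → Walk S u w es) × Acyclic S

  IsSubgraph : Subset n → Subset m → Set
  IsSubgraph W F = Nonempty W ×
    (∀ e → e ∈ F → proj₁ (ends G e) ∈ W × proj₂ (ends G e) ∈ W)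

  BispanningSub : Subset n → Subset m → Set
  BispanningSub W F = IsSubgraph W F ×
    Σ (Subset m) λ S → S ⊆ F × SpanningTreeOn W S × SpanningTreeOn W (F ─ S)

  Bispanning : Set
  Bispanning = BispanningSub ⊤ ⊤

  Atomic : Set
  Atomic = Bispanning ×
    (∀ W F → BispanningSub W F → (W ≡ ⊤ × F ≡ ⊤) ⊎ ∣ W ∣ ≡ 1)

redirect : ∀ {n m} → Graph n m → Fin m → Fin n → Fin n → Graph n m
redirect {n} {m} G e a b = record { ends = f }
  where
  open import Data.Fin using (_≟_)
  open import Relation.Nullary using (yes; no)
  f : Fin m → Fin n × Fin n
  f e' with e' Data.Fin.≟ e
  ... | yes _ = (a , b)
  ... | no _ = ends G e'

{-# OPTIONS --safe #-}
-- Deleting v leaves a spanning tree and a two-component forest of G − v, and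
-- G_{a,b} is bispanning as soon as some such pair of forests has a and b in
-- different components of its second member.  To reach this by exchanges,
-- shrink V − v to smaller and smaller sets C₀ ⊇ C₁ ⊇ … around a, where C_{k+1}
-- consists of the vertices joined to a inside C_k in both forests.  If
-- u ∈ C_{k+1} and w ∈ C_k ∖ C_{k+1}, one of the two forests has a u–w trail
-- inside C_{k-1} that leaves C_k by some edge f = pq.  Inductively the forests
-- can be changed, outside C_{k-1} only, so as to separate p from q; moving f to
-- the other forest then separates u from w.  Hence either a and b can be
-- separated, or the sets stabilise at some W containing a and b; such a W
-- spans a bispanning subgraph, which atomicity forbids.
module Submission where

open import Defs
open import Data.Bool using (Bool; true; false; not)
open import Data.Bool.Properties using (not-involutive; not-¬; ¬-not)
import Data.Bool.Properties as Bool
open import Data.Empty using (⊥; ⊥-elim)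
open import Data.Fin using (Fin; _≟_)
open import Data.Fin.Properties using (any?)
open import Data.Fin.Subset using (Subset; ∁; ⁅_⁆; _∪_; _∩_; _∈_; _∉_; _⊆_; _⊂_; _⊃_; _─_; ⊤; ∣_∣)
open import Data.Fin.Subset.Induction using (⊂-wellFounded; ⊃-wellFounded; Acc; acc)
open import Data.Fin.Subset.Properties
open import Data.List using (List; []; _∷_)
import Data.List.Membership.Propositional as List
open import Data.List.Membership.DecPropositional using () renaming (_∈?_ to ∈-dec)
open import Data.List.Relation.Unary.All.Properties using (¬Any⇒All¬)
import Data.List.Relation.Unary.AllPairs as AllPairs
open import Data.List.Relation.Unary.All using (All; []; _∷_)
open import Data.List.Relation.Unary.Any using (here; there)
open import Data.List.Relation.Unary.Unique.Propositional using (Unique)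
open import Data.Nat using (ℕ)
import Data.Nat.Properties as ℕ
open import Data.Product using (_×_; _,_; proj₁; proj₂; ∃; ∃₂; map₁; map₂)
open import Data.Product.Properties using (,-injective)
open import Data.Sum using (_⊎_; inj₁; inj₂; [_,_]′; swap)
import Data.Sum as Sum
open import Data.Vec using (tabulate; _∷_; here; there)
open import Data.Vec.Functional using (updateAt)
open import Data.Vec.Functional.Properties using (updateAt-updates; updateAt-minimal)
open import Data.Vec.Properties using (lookup∘tabulate; lookup⇒[]=; []=⇒lookup)
open import Function using (_∘_; id; const)
open import Relation.Nullary using (¬_; Dec; yes; no; does; contradiction; ¬?; _×-dec_; _⊎-dec_)
open import Relation.Nullary.Decidable using (dec-true; dec-false)
open import Relation.Unary using (Decidable)
open import Relation.Binary.PropositionalEquality using (_≡_; _≢_; refl; sym; trans; cong; subst; ≢-sym)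

-- Finite sets and two-colourings of the edges.

subset : ∀ {n} {P : Fin n → Set} → Decidable P → Subset n
subset P? = tabulate (does ∘ P?)

module _ {n} {P : Fin n → Set} (P? : Decidable P) where

  ∈-subset⁺ : ∀ {i} → P i → i ∈ subset P?
  ∈-subset⁺ {i} p = lookup⇒[]= i _ (trans (lookup∘tabulate _ i) (dec-true (P? i) p))

  ∈-subset⁻ : ∀ {i} → i ∈ subset P? → P i
  ∈-subset⁻ {i} i∈ with P? i | trans (sym (lookup∘tabulate (does ∘ P?) i)) ([]=⇒lookup i∈)
  ... | yes p | _ = p

x∈p─q⇒x∉q : ∀ {n} (p q : Subset n) {x} → x ∈ p ─ q → x ∉ q
x∈p─q⇒x∉q (_ ∷ p) (_ ∷ q) (there x∈) (there x∈q) = x∈p─q⇒x∉q p q x∈ x∈q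

two-members : ∀ {n} {p : Subset n} {x y} → x ∈ p → y ∈ p → x ≢ y → ∣ p ∣ ≢ 1
two-members {p = p} {x} {y} x∈p y∈p x≢y ∣p∣≡1 = ℕ.<⇒≢ ∣x∣<∣p∣ (trans (∣⁅x⁆∣≡1 x) (sym ∣p∣≡1))
  where
  ∣x∣<∣p∣ = p⊂q⇒∣p∣<∣q∣
    ( (λ z∈ → subst (_∈ p) (sym (x∈⁅y⁆⇒x≡y x z∈)) x∈p)
    , y , y∈p , (x≢y ∘ sym ∘ x∈⁅y⁆⇒x≡y x) )

_∖_ : ∀ {m} → (Fin m → Set) → Fin m → (Fin m → Set)
(P ∖ f) e = P e × e ≢ f

-- Two disjoint edge sets that exhaust `F` are stored as a colour on every edge, `Class` restricting
-- attention to `F`. An exchange is then a single recolouring, and a claim about both sets is one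
-- claim quantified over the colour.
Colouring : ℕ → Set
Colouring m = Fin m → Bool

Class : ∀ {m} → Subset m → Colouring m → Bool → Fin m → Set
Class F χ c e = e ∈ F × χ e ≡ c

Class? : ∀ {m} (F : Subset m) χ c → Decidable (Class F χ c)
Class? F χ c e = (e ∈? F) ×-dec (χ e Bool.≟ c)

recolour : ∀ {m} → Colouring m → Fin m → Bool → Colouring m
recolour χ f c = updateAt χ f (const c)

module _ {m} {F : Subset m} (χ : Colouring m) (f : Fin m) (c : Bool) where

  recolour⁺ : ∀ {d e} → Class F χ d e → e ≢ f → Class F (recolour χ f c) d e
  recolour⁺ (e∈F , χe) e≢f = e∈F , trans (updateAt-minimal _ f χ e≢f) χe

  recolour⁻ : ∀ {d e} → Class F (recolour χ f c) d e → e ≢ f → Class F χ d e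
  recolour⁻ (e∈F , χe) e≢f = e∈F , trans (sym (updateAt-minimal _ f χ e≢f)) χe

  recolour-other : ∀ {d e} → c ≢ d → Class F (recolour χ f c) d e → e ≢ f
  recolour-other c≢d (_ , χe) refl = c≢d (trans (sym (updateAt-updates f χ)) χe)

-- Edges and their endpoints.

module _ {n m : ℕ} (G : Graph n m) where

  private variable
    u w s t p q : Fin n
    e f : Fin m
    es : List (Fin m)
    P Q : Fin m → Set

  joins-sym : Joins G e u w → Joins G e w u
  joins-sym = swap

  joins-ends : ∀ e → Joins G e (proj₁ (ends G e)) (proj₂ (ends G e))
  joins-ends e = inj₁ refl

  joins-unique : Joins G e u w → Joins G e s t → (u ≡ s × w ≡ t) ⊎ (u ≡ t × w ≡ s)
  joins-unique (inj₁ i) (inj₁ j) = inj₁ (,-injective (trans (sym i) j))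
  joins-unique (inj₁ i) (inj₂ j) = inj₂ (,-injective (trans (sym i) j))
  joins-unique (inj₂ i) (inj₁ j) = let w≡s , u≡t = ,-injective (trans (sym i) j) in inj₂ (u≡t , w≡s)
  joins-unique (inj₂ i) (inj₂ j) = let w≡t , u≡s = ,-injective (trans (sym i) j) in inj₁ (u≡s , w≡t)

  joins-other : Joins G e u w → Joins G e u t → w ≡ t
  joins-other j k with joins-unique j k
  ... | inj₁ (_ , w≡t) = w≡t
  ... | inj₂ (u≡t , w≡u) = trans w≡u u≡t

  joins⇒incident : Joins G e u w → Incident G e u
  joins⇒incident (inj₁ j) = inj₁ (cong proj₁ j)
  joins⇒incident (inj₂ j) = inj₂ (cong proj₂ j)

  incident⇒end : Joins G e u w → Incident G e s → u ≡ s ⊎ w ≡ s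
  incident⇒end (inj₁ j) (inj₁ i) = inj₁ (trans (sym (cong proj₁ j)) i)
  incident⇒end (inj₁ j) (inj₂ i) = inj₂ (trans (sym (cong proj₂ j)) i)
  incident⇒end (inj₂ j) (inj₁ i) = inj₂ (trans (sym (cong proj₁ j)) i)
  incident⇒end (inj₂ j) (inj₂ i) = inj₁ (trans (sym (cong proj₂ j)) i)

  incident? : ∀ e u → Dec (Incident G e u)
  incident? e u = (proj₁ (ends G e) ≟ u) ⊎-dec (proj₂ (ends G e) ≟ u)

  loopless-joins : Loopless G → Joins G e u w → u ≢ w
  loopless-joins ll (inj₁ j) refl = ll _ (trans (cong proj₁ j) (sym (cong proj₂ j)))
  loopless-joins ll (inj₂ j) refl = ll _ (trans (cong proj₁ j) (sym (cong proj₂ j)))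

  Inside : Subset n → Fin m → Set
  Inside D e = proj₁ (ends G e) ∈ D × proj₂ (ends G e) ∈ D

  inside? : ∀ D → Decidable (Inside D)
  inside? D e = (proj₁ (ends G e) ∈? D) ×-dec (proj₂ (ends G e) ∈? D)

  inside⁺ : ∀ {D} → Joins G e u w → u ∈ D → w ∈ D → Inside D e
  inside⁺ {D = D} (inj₁ j) u∈ w∈ = subst (_∈ D) (sym (cong proj₁ j)) u∈ , subst (_∈ D) (sym (cong proj₂ j)) w∈
  inside⁺ {D = D} (inj₂ j) u∈ w∈ = subst (_∈ D) (sym (cong proj₁ j)) w∈ , subst (_∈ D) (sym (cong proj₂ j)) u∈

  inside⁻ : ∀ {D} → Joins G e u w → Inside D e → w ∈ D
  inside⁻ {D = D} (inj₁ j) (_ , i) = subst (_∈ D) (cong proj₂ j) i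
  inside⁻ {D = D} (inj₂ j) (i , _) = subst (_∈ D) (cong proj₁ j) i

  inside-mono : ∀ {C D} → C ⊆ D → Inside C e → Inside D e
  inside-mono C⊆D (i , j) = C⊆D i , C⊆D j

  -- Connectivity

  -- Unlike `Walk`, this takes any predicate on edges and keeps no edge list, so deleting an edge or
  -- restricting to a vertex set only changes the predicate.
  data Conn (P : Fin m → Set) : Fin n → Fin n → Set where
    refl : Conn P u u
    step : P e → Joins G e u w → Conn P w t → Conn P u t

  conn-mono : (∀ {e} → P e → Q e) → Conn P u w → Conn Q u w
  conn-mono h refl = refl
  conn-mono h (step pe j c) = step (h pe) j (conn-mono h c)

  conn-trans : Conn P u w → Conn P w t → Conn P u t
  conn-trans refl d = d
  conn-trans (step pe j c) d = step pe j (conn-trans c d)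

  conn-edge : P e → Joins G e u w → Conn P u w
  conn-edge pe j = step pe j refl

  conn-sym : Conn P u w → Conn P w u
  conn-sym refl = refl
  conn-sym (step pe j c) = conn-trans (conn-sym c) (conn-edge pe (joins-sym j))

  data Trail (P : Fin m → Set) : Fin n → Fin n → List (Fin m) → Set where
    nil  : Trail P u u []
    cons : P e → Joins G e u w → ¬ (e List.∈ es) → Trail P w t es → Trail P u t (e ∷ es)

  trail-from : Trail P s t es → e List.∈ es → Joins G e u w → ∃ (Trail P u t)
  trail-from tr@(cons _ j _ tl) (here refl) k with joins-unique j k
  ... | inj₁ (refl , _) = _ , tr
  ... | inj₂ (_ , refl) = _ , tl
  trail-from (cons _ _ _ tl) (there e∈) k = trail-from tl e∈ k

  trail : Conn P u w → ∃ (Trail P u w)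
  trail refl = _ , nil
  trail (step {e = e} pe j c) with trail c
  ... | es , tr with ∈-dec _≟_ e es
  ...   | yes e∈ = trail-from tr e∈ j
  ...   | no e∉  = _ , cons pe j e∉ tr

  trail-avoids : Trail P u w es → ¬ (e List.∈ es) → Conn (P ∖ e) u w
  trail-avoids nil _ = refl
  trail-avoids (cons pe j _ tl) e∉ = step (pe , λ { refl → e∉ (here refl) }) j (trail-avoids tl (e∉ ∘ there))

  trail-walk : ∀ {S} → (∀ {e} → P e → e ∈ S) → Trail P u w es → Walk G S u w es
  trail-walk h nil = here
  trail-walk h (cons pe j _ tl) = step (h pe) j (trail-walk h tl)

  trail-unique : Trail P u w es → Unique es
  trail-unique nil = AllPairs.[]
  trail-unique (cons _ _ e∉ tl) = ¬Any⇒All¬ _ e∉ AllPairs.∷ trail-unique tl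

  trail-edges : Trail P u w es → e List.∈ es → P e
  trail-edges (cons pe _ _ _) (here refl) = pe
  trail-edges (cons _ _ _ tl) (there e∈) = trail-edges tl e∈

  walk-conn : ∀ {S} → (∀ {e} → e ∈ S → P e) → Walk G S u w es → Conn P u w
  walk-conn h here = refl
  walk-conn h (step e∈ j wk) = step (h e∈) j (walk-conn h wk)

  walk-avoids : ∀ {S} → (∀ {e} → e ∈ S → P e) → All (e ≢_) es → Walk G S u w es → Conn (P ∖ e) u w
  walk-avoids h [] here = refl
  walk-avoids h (e≢ ∷ all) (step e∈ j wk) = step (h e∈ , ≢-sym e≢) j (walk-avoids h all wk)

  -- The trail is cut at its first exit from `D`. As no edge is repeated, both remaining pieces
  -- avoid the exit edge `f`, which is why a trail is taken and not a bare connection.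
  leave : ∀ {D} → Trail P u w es → u ∈ D →
    Conn (λ e → P e × Inside D e) u w ⊎
    ∃ λ f → ∃₂ λ p q → P f × Joins G f p q × p ∈ D × q ∉ D × Conn (P ∖ f) u p × Conn (P ∖ f) q w
  leave nil _ = inj₁ refl
  leave {D = D} (cons {w = u′} pe j e∉ tl) u∈ with u′ ∈? D
  ... | no u′∉ = inj₂ (_ , _ , _ , pe , j , u∈ , u′∉ , refl , trail-avoids tl e∉)
  ... | yes u′∈ with leave tl u′∈
  ...   | inj₁ c = inj₁ (step (pe , inside⁺ j u∈ u′∈) j c)
  ...   | inj₂ (f , p , q , pf , k , p∈ , q∉ , c , d) = inj₂ (f , p , q , pf , k , p∈ , q∉ , step (pe , e≢f) j c , d)
    where
    e≢f : _ ≢ f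
    e≢f refl = q∉ (inside⁻ k (inside⁺ j u∈ u′∈))

  -- The connection is cut at its first arrival at `v`, so no earlier edge meets `v`.
  last-edge : ∀ v → Conn P u v →
    u ≡ v ⊎ ∃₂ λ e x → P e × Joins G e v x × Conn (λ e → P e × ¬ Incident G e v) u x
  last-edge v refl = inj₁ refl
  last-edge {u = u} v (step {w = u′} pe j c) with u ≟ v | u′ ≟ v
  ... | yes u≡v | _ = inj₁ u≡v
  ... | no _ | yes refl = inj₂ (_ , _ , pe , joins-sym j , refl)
  ... | no u≢v | no u′≢v with last-edge v c
  ...   | inj₁ u′≡v = contradiction u′≡v u′≢v
  ...   | inj₂ (e , x , pe′ , k , d) = inj₂ (e , x , pe′ , k , step (pe , [ u≢v , u′≢v ]′ ∘ incident⇒end j) j d)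

  Boundary : Subset n → Fin m → Set
  Boundary C e = ∃₂ λ u w → Joins G e u w × u ∈ C × w ∉ C

  boundary? : ∀ C → Decidable (Boundary C)
  boundary? C e with proj₁ (ends G e) ∈? C | proj₂ (ends G e) ∈? C
  ... | yes i | no j = yes (_ , _ , joins-ends e , i , j)
  ... | no i | yes j = yes (_ , _ , joins-sym (joins-ends e) , j , i)
  ... | yes i | yes j = no λ { (_ , _ , k , u∈ , w∉) → w∉ (inside⁻ k (i , j)) }
  ... | no i | no j = no λ { (_ , _ , inj₁ k , u∈ , w∉) → i (subst (_∈ C) (sym (cong proj₁ k)) u∈)
                           ; (_ , _ , inj₂ k , u∈ , w∉) → j (subst (_∈ C) (sym (cong proj₂ k)) u∈) }

  -- The set grows from `a` by far ends of boundary edges satisfying `P` until there are none.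
  -- Membership in it decides connection to `a`.
  component : Decidable P → ∀ a → ∃ λ C → (∀ {u} → u ∈ C → Conn P a u) × (∀ {u} → Conn P a u → u ∈ C)
  component {P = P} P? a = grow ⁅ a ⁆ (⊃-wellFounded ⁅ a ⁆) (x∈⁅x⁆ a)
      (λ u∈ → subst (Conn P a) (sym (x∈⁅y⁆⇒x≡y a u∈)) refl)
    where
    grow : ∀ C → Acc _⊃_ C → a ∈ C → (∀ {u} → u ∈ C → Conn P a u) →
      ∃ λ C → (∀ {u} → u ∈ C → Conn P a u) × (∀ {u} → Conn P a u → u ∈ C)
    grow C (acc rec) a∈ sound with any? (λ e → P? e ×-dec boundary? C e)
    ... | yes (e , pe , u , w , j , u∈ , w∉) =
      grow (C ∪ ⁅ w ⁆) (rec (p⊆p∪q ⁅ w ⁆ , w , q⊆p∪q C ⁅ w ⁆ (x∈⁅x⁆ w) , w∉)) (p⊆p∪q ⁅ w ⁆ a∈)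
        ([ sound , (λ t∈ → subst (Conn P a) (sym (x∈⁅y⁆⇒x≡y w t∈)) (conn-trans (sound u∈) (conn-edge pe j))) ]′
          ∘ x∈p∪q⁻ C ⁅ w ⁆)
    ... | no none = C , sound , closed a∈
      where
      closed : ∀ {u w} → u ∈ C → Conn P u w → w ∈ C
      closed u∈ refl = u∈
      closed u∈ (step {w = w} pe j c) with w ∈? C
      ... | yes w∈ = closed w∈ c
      ... | no w∉ = contradiction (_ , pe , _ , _ , j , u∈ , w∉) none

  -- Forests

  -- Acyclicity in the form that exchanges use: every edge is a bridge. A closed walk without
  -- repetitions that starts with `e` amounts to a connection between the ends of `e` avoiding `e`.
  Forest : (Fin m → Set) → Set
  Forest P = ∀ {e p q} → P e → Joins G e p q → ¬ Conn (P ∖ e) p q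

  forest-mono : (∀ {e} → P e → Q e) → Forest Q → Forest P
  forest-mono h forest pe j c = forest (h pe) j (conn-mono (map₁ h) c)

  forest⇒acyclic : ∀ {S} → (∀ {e} → e ∈ S → P e) → Forest P → Acyclic G S
  forest⇒acyclic h forest u [] wk uniq = refl
  forest⇒acyclic h forest u (e ∷ es) (step e∈ j wk) (e∉ AllPairs.∷ _) =
    contradiction (conn-sym (walk-avoids h e∉ wk)) (forest (h e∈) j)

  acyclic⇒forest : ∀ {S} → (∀ {e} → P e → e ∈ S) → Acyclic G S → Forest P
  acyclic⇒forest h acyclic {e} pe j c with trail c
  ... | es , tr with acyclic _ (e ∷ es) (step (h pe) (joins-sym j) (trail-walk (h ∘ proj₁) tr))
                       (¬Any⇒All¬ _ (λ e∈ → proj₂ (trail-edges tr e∈) refl) AllPairs.∷ trail-unique tr)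
  ...   | ()

  -- However often `f` is crossed, one crossing suffices: crossings there and back cancel, since a
  -- rest that returns to an end of `f` already reached can be shortened.
  conn-without : Joins G f p q → (∀ {e} → P e → e ≡ f ⊎ Q e) → Conn P s t →
    Conn Q s t ⊎ (Conn Q s p × Conn Q q t) ⊎ (Conn Q s q × Conn Q p t)
  conn-without jf h refl = inj₁ refl
  conn-without jf h (step pe j c) with h pe | conn-without jf h c
  ... | inj₂ qe | inj₁ d = inj₁ (step qe j d)
  ... | inj₂ qe | inj₂ (inj₁ (d , d′)) = inj₂ (inj₁ (step qe j d , d′))
  ... | inj₂ qe | inj₂ (inj₂ (d , d′)) = inj₂ (inj₂ (step qe j d , d′))
  ... | inj₁ refl | r with joins-unique j jf
  ...   | inj₁ (refl , refl) = [ (λ d → inj₂ (inj₁ (refl , d))) , [ (λ d → inj₂ (inj₁ (refl , proj₂ d))) , inj₁ ∘ proj₂ ]′ ]′ r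
  ...   | inj₂ (refl , refl) = [ (λ d → inj₂ (inj₂ (refl , d))) , [ inj₁ ∘ proj₂ , (λ d → inj₂ (inj₂ (refl , proj₂ d))) ]′ ]′ r

  -- A cycle through `f` would connect `p` to `q` in `Q`. A cycle through another edge `e` either
  -- avoids `f`, against the forest `Q`, or crosses it; then the two remaining pieces together with
  -- `e` again connect `p` to `q`.
  forest-add : Joins G f p q → (∀ {e} → P e → e ≡ f ⊎ Q e) → Forest Q → ¬ Conn Q p q → Forest P
  forest-add {f = f} {p} {q} {P} {Q} jf h forest sep {e} {s} {t} pe j c with e ≟ f
  ... | yes refl = [ (λ { (refl , refl) → sep c′ }) , (λ { (refl , refl) → sep (conn-sym c′) }) ]′ (joins-unique j jf)
    where
    c′ : Conn Q s t
    c′ = conn-mono (λ { (px , x≢f) → [ (λ x≡f → contradiction x≡f x≢f) , id ]′ (h px) }) c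
  ... | no e≢f = [ forest qe j , [ through , through′ ]′ ]′ (conn-without jf (λ (px , x≢e) → Sum.map₂ (_, x≢e) (h px)) c)
    where
    qe : Q e
    qe = [ (λ e≡f → contradiction e≡f e≢f) , id ]′ (h pe)
    through : ¬ (Conn (Q ∖ e) s p × Conn (Q ∖ e) q t)
    through (d , d′) = sep (conn-trans (conn-sym (conn-mono proj₁ d))
      (conn-trans (conn-edge qe j) (conn-sym (conn-mono proj₁ d′))))
    through′ : ¬ (Conn (Q ∖ e) s q × Conn (Q ∖ e) p t)
    through′ (d , d′) = sep (conn-trans (conn-mono proj₁ d′)
      (conn-trans (conn-edge qe (joins-sym j)) (conn-mono proj₁ d)))

  conn-add : ∀ {D : Subset n} → Joins G f p q → (∀ {e} → Q e → P e) → P f →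
    (∀ {u} → u ∈ D → Conn Q u p ⊎ Conn Q u q) → ∀ {u w} → u ∈ D → w ∈ D → Conn P u w
  conn-add {p = p} {P = P} {D = D} jf h pf covered u∈ w∈ = conn-trans (to-p u∈) (conn-sym (to-p w∈))
    where
    to-p : ∀ {u} → u ∈ D → Conn P u p
    to-p u∈ = [ conn-mono h , (λ c → conn-trans (conn-mono h c) (conn-edge pf (joins-sym jf))) ]′ (covered u∈)

  -- Two edge-disjoint spanning trees as a colouring.

  record TwoTrees (W : Subset n) (F : Subset m) (χ : Colouring m) : Set where
    field
      connected : ∀ c {u w} → u ∈ W → w ∈ W → Conn (Class F χ c) u w
      forest    : ∀ c → Forest (Class F χ c)

  twoTrees⇒bispanning : ∀ {W F χ} → IsSubgraph G W F → TwoTrees W F χ → BispanningSub G W F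
  twoTrees⇒bispanning {W} {F} {χ} sub tt =
      sub , S , proj₁ ∘ S⁻ , tree true ∈-S S⁻ , tree false ∈-F─S F─S⁻
    where
    open TwoTrees tt
    S : Subset m
    S = subset (Class? F χ true)
    ∈-S : ∀ {e} → Class F χ true e → e ∈ S
    ∈-S = ∈-subset⁺ (Class? F χ true)
    S⁻ : ∀ {e} → e ∈ S → Class F χ true e
    S⁻ = ∈-subset⁻ (Class? F χ true)
    ∈-F─S : ∀ {e} → Class F χ false e → e ∈ F ─ S
    ∈-F─S (e∈F , χe) = x∈p∧x∉q⇒x∈p─q e∈F (λ e∈S → not-¬ χe (proj₂ (S⁻ e∈S)))
    F─S⁻ : ∀ {e} → e ∈ F ─ S → Class F χ false e
    F─S⁻ e∈ = p─q⊆p F S e∈ , ¬-not (λ χe → x∈p─q⇒x∉q F S e∈ (∈-S (p─q⊆p F S e∈ , χe)))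
    tree : ∀ c {T} → (∀ {e} → Class F χ c e → e ∈ T) → (∀ {e} → e ∈ T → Class F χ c e) → SpanningTreeOn G W T
    tree c h h′ = (λ u w u∈ w∈ → map₂ (trail-walk h) (trail (connected c u∈ w∈))) , forest⇒acyclic h′ (forest c)

  bispanning⇒twoTrees : ∀ {W F} → BispanningSub G W F → ∃ (TwoTrees W F)
  bispanning⇒twoTrees {W} {F} (_ , S , S⊆F , (connS , acS) , (connT , acT)) = χ , record
      { connected = λ { true u∈ w∈ → walk-conn ∈S⇒ (proj₂ (connS _ _ u∈ w∈))
                      ; false u∈ w∈ → walk-conn ∈T⇒ (proj₂ (connT _ _ u∈ w∈)) }
      ; forest = λ { true → acyclic⇒forest ⇒∈S acS ; false → acyclic⇒forest ⇒∈T acT } }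
    where
    χ : Colouring m
    χ e = does (e ∈? S)
    ∈S⇒ : ∀ {e} → e ∈ S → Class F χ true e
    ∈S⇒ {e} e∈ = S⊆F e∈ , dec-true (e ∈? S) e∈
    ∈T⇒ : ∀ {e} → e ∈ F ─ S → Class F χ false e
    ∈T⇒ {e} e∈ = p─q⊆p F S e∈ , dec-false (e ∈? S) (x∈p─q⇒x∉q F S e∈)
    ⇒∈S : ∀ {e} → Class F χ true e → e ∈ S
    ⇒∈S {e} (_ , eq) with yes e∈ ← e ∈? S = e∈
    ⇒∈T : ∀ {e} → Class F χ false e → e ∈ F ─ S
    ⇒∈T {e} (e∈F , eq) with no e∉ ← e ∈? S = x∈p∧x∉q⇒x∈p─q e∈F e∉

  -- Augmentation

  -- Both classes become spanning trees of W once an edge joining p and q is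
  -- added to the class of colour `not hue`.
  record Completable (W : Subset n) (F : Subset m) (χ : Colouring m) (p q : Fin n) : Set where
    field
      hue       : Bool
      connected : ∀ {u w} → u ∈ W → w ∈ W → Conn (Class F χ hue) u w
      forest    : ∀ c → Forest (Class F χ c)
      separated : ¬ Conn (Class F χ (not hue)) p q
      covered   : ∀ {u} → u ∈ W → Conn (Class F χ (not hue)) u p ⊎ Conn (Class F χ (not hue)) u q

  -- The class of colour `hue` connects all of `W`, so `c` must be the other colour. That class has
  -- just two components on `W`, those of `p` and of `q`; `u` and `w` lie in different ones and can
  -- represent them instead.
  completable-at : ∀ {W F χ} → Completable W F χ p q → ∀ c {u w} → u ∈ W → w ∈ W →
    ¬ Conn (Class F χ c) u w → Completable W F χ u w
  completable-at {W = W} {F} {χ} cp c {u} {w} u∈ w∈ ¬uw with c Bool.≟ Completable.hue cp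
  ... | yes refl = contradiction (Completable.connected cp u∈ w∈) ¬uw
  ... | no c≢hue with refl ← ¬-not c≢hue = record
      { hue = hue ; connected = connected ; forest = forest ; separated = ¬uw ; covered = covered′ }
    where
    open Completable cp
    _~_ : Fin n → Fin n → Set
    _~_ = Conn (Class F χ (not hue))
    covered′ : ∀ {s} → s ∈ W → (s ~ u) ⊎ (s ~ w)
    covered′ s∈ with covered u∈ | covered w∈ | covered s∈
    ... | inj₁ a | inj₁ b | _ = contradiction (conn-trans a (conn-sym b)) ¬uw
    ... | inj₂ a | inj₂ b | _ = contradiction (conn-trans a (conn-sym b)) ¬uw
    ... | inj₁ a | inj₂ b | inj₁ d = inj₁ (conn-trans d (conn-sym a))
    ... | inj₁ a | inj₂ b | inj₂ d = inj₂ (conn-trans d (conn-sym b))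
    ... | inj₂ a | inj₁ b | inj₁ d = inj₂ (conn-trans d (conn-sym b))
    ... | inj₂ a | inj₁ b | inj₂ d = inj₁ (conn-trans d (conn-sym a))

  -- Moving `f` to the other class joins the two components there into a tree. The tree that loses
  -- `f` falls into two parts, one with `u` and `p`, the other with `q` and `w`. So the colours swap
  -- roles, and the separated pair is now `u`, `w`.
  exchange : ∀ {W F χ c} → Completable W F χ p q → Class F χ c f → Joins G f p q → p ∈ W →
    Conn (Class F χ c ∖ f) u p → Conn (Class F χ c ∖ f) q w → Completable W F (recolour χ f (not c)) u w
  exchange {p} {q} {f} {u} {w} {W} {F} {χ} {c} cp cf@(f∈F , _) jf p∈ up qw with c Bool.≟ Completable.hue cp
  -- An edge `f` of colour `not hue` would itself connect `p` to `q`.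
  ... | no c≢hue with refl ← ¬-not c≢hue = contradiction (conn-edge cf jf) (Completable.separated cp)
  ... | yes refl = record
      { hue = not c
      ; connected = conn-add jf add (f∈F , updateAt-updates f χ) covered
      ; forest = forest′
      -- The new `hue` is `not c`, so the broken class has colour `not (not c)`, which has to be
      -- rewritten to `c`.
      ; separated = separated′ ∘ subst (λ d → Conn (Class F χ′ d) u w) (not-involutive c)
      ; covered = λ {s} s∈ → subst (λ d → Conn (Class F χ′ d) s u ⊎ Conn (Class F χ′ d) s w)
                               (sym (not-involutive c)) (covered′ s∈)
      }
    where
    open Completable cp
    χ′ : Colouring m
    χ′ = recolour χ f (not c)
    not-c≢c : not c ≢ c
    not-c≢c = ≢-sym (not-¬ refl)
    add : ∀ {e} → Class F χ (not c) e → Class F χ′ (not c) e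
    add {e} k = recolour⁺ χ f (not c) k (λ { refl → not-¬ (proj₂ cf) (proj₂ k) })
    added : ∀ {e} → Class F χ′ (not c) e → e ≡ f ⊎ Class F χ (not c) e
    added {e} k with e ≟ f
    ... | yes e≡f = inj₁ e≡f
    ... | no e≢f = inj₂ (recolour⁻ χ f (not c) k e≢f)
    remove : ∀ {e} → (Class F χ c ∖ f) e → Class F χ′ c e
    remove (k , e≢f) = recolour⁺ χ f (not c) k e≢f
    removed : ∀ {e} → Class F χ′ c e → (Class F χ c ∖ f) e
    removed k = let e≢f = recolour-other χ f (not c) not-c≢c k in recolour⁻ χ f (not c) k e≢f , e≢f
    forest′ : ∀ d → Forest (Class F χ′ d)
    forest′ d with d Bool.≟ c
    ... | yes refl = forest-mono (proj₁ ∘ removed) (forest c)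
    ... | no d≢c with refl ← ¬-not d≢c = forest-add jf added (forest (not c)) separated
    separated′ : ¬ Conn (Class F χ′ c) u w
    -- A surviving connection from `u` to `w` would bypass `f` between `p` and `q`.
    separated′ uw = forest c cf jf (conn-trans (conn-sym up) (conn-trans (conn-mono removed uw) (conn-sym qw)))
    split : ∀ {e} → Class F χ c e → e ≡ f ⊎ (Class F χ c ∖ f) e
    split {e} k with e ≟ f
    ... | yes e≡f = inj₁ e≡f
    ... | no e≢f = inj₂ (k , e≢f)
    covered′ : ∀ {s} → s ∈ W → Conn (Class F χ′ c) s u ⊎ Conn (Class F χ′ c) s w
    covered′ s∈ = [ to-u , [ to-u ∘ proj₁ , to-w ∘ proj₁ ]′ ]′ (conn-without jf split (connected s∈ p∈))
      where
      to-u = λ d → inj₁ (conn-mono remove (conn-trans d (conn-sym up)))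
      to-w = λ d → inj₂ (conn-mono remove (conn-trans d qw))

  -- Shrinking sets around `a`.

  module Augment (V : Subset n) (F : Subset m) (χ₀ : Colouring m) (F-inside : ∀ {e} → e ∈ F → Inside V e)
                 (a : Fin n) (a∈V : a ∈ V) where

    ClassIn : Subset n → Bool → Fin m → Set
    ClassIn D c e = Class F χ₀ c e × Inside D e

    -- One shrinking step, from `D` to `C`. The last component names a colour in which a dropped
    -- vertex is cut off from `a`; the next exchange takes place in that colour.
    Core : Subset n → Subset n → Set
    Core D C = a ∈ C × C ⊆ D × (∀ c {u} → u ∈ C → Conn (ClassIn D c) a u) ×
      (∀ {u} → u ∈ D → u ∉ C → ∃ λ c → ¬ Conn (ClassIn D c) a u)

    core : ∀ D → a ∈ D → ∃ (Core D)
    core D a∈ with component (λ e → Class? F χ₀ true e ×-dec inside? D e) a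
                 | component (λ e → Class? F χ₀ false e ×-dec inside? D e) a
    ... | C₁ , sound₁ , complete₁ | C₂ , sound₂ , complete₂ =
        D ∩ (C₁ ∩ C₂)
      , x∈p∩q⁺ (a∈ , x∈p∩q⁺ (complete₁ refl , complete₂ refl))
      , p∩q⊆p D (C₁ ∩ C₂)
      , (λ { true u∈ → sound₁ (p∩q⊆p C₁ C₂ (p∩q⊆q D (C₁ ∩ C₂) u∈))
           ; false u∈ → sound₂ (p∩q⊆q C₁ C₂ (p∩q⊆q D (C₁ ∩ C₂) u∈)) })
      , outside
      where
      outside : ∀ {u} → u ∈ D → u ∉ D ∩ (C₁ ∩ C₂) → ∃ λ c → ¬ Conn (ClassIn D c) a u
      outside {u} u∈ u∉ with u ∈? C₁
      ... | no u∉₁ = true , u∉₁ ∘ complete₁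
      ... | yes u∈₁ = false , λ c → u∉ (x∈p∩q⁺ (u∈ , x∈p∩q⁺ (u∈₁ , complete₂ c)))

    Agree : Subset n → Colouring m → Set
    Agree D χ = ∀ {e} → Inside D e → χ e ≡ χ₀ e

    -- Two consecutive sets of the shrinking sequence. By `Agree`, a separating colouring differs
    -- from `χ₀` only on edges not inside `outer`, so trails of `χ₀` inside `outer` keep their
    -- colour.
    record Stage (outer inner : Subset n) : Set where
      field
        a∈inner     : a ∈ inner
        inner⊆outer : inner ⊆ outer
        outer⊆V     : outer ⊆ V
        linked      : ∀ c {u} → u ∈ inner → Conn (ClassIn outer c) a u
        separable   : ∀ {u w} → u ∈ inner → w ∈ outer → w ∉ inner →
                      ∃ λ χ → Agree outer χ × Completable V F χ u w

    first-stage : Completable V F χ₀ p q → ∀ {C} → Core V C → Stage V C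
    first-stage cp (a∈ , C⊆V , sound , outside) = record
      { a∈inner = a∈ ; inner⊆outer = C⊆V ; outer⊆V = id ; linked = sound
      ; separable = λ u∈ w∈ w∉ → let c , ¬aw = outside w∈ w∉ in
          χ₀ , (λ _ → refl) , completable-at cp c (C⊆V u∈) w∈
            (λ uw → ¬aw (conn-trans (sound c u∈) (conn-mono (λ k → k , F-inside (proj₁ k)) uw))) }

    next-stage : ∀ {outer inner} → Stage outer inner → ∀ {C} → Core inner C → Stage inner C
    next-stage {outer} {inner} st {C} (a∈ , C⊆ , sound , outside) = record
        { a∈inner = a∈ ; inner⊆outer = C⊆ ; outer⊆V = outer⊆V ∘ inner⊆outer ; linked = sound
        ; separable = separable′ }
      where
      open Stage st
      separable′ : ∀ {u w} → u ∈ C → w ∈ inner → w ∉ C → ∃ λ χ → Agree inner χ × Completable V F χ u w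
      separable′ {u} {w} u∈ w∈ w∉ with outside w∈ w∉
      -- Both `u` and `w` are linked to `a` in colour `c` inside `outer`, hence to each other by a
      -- trail there. Had it stayed in `inner`, `w` would not be cut off from `a`.
      ... | c , ¬aw with leave (proj₂ (trail (conn-trans (conn-sym (linked c (C⊆ u∈))) (linked c w∈)))) (C⊆ u∈)
      ...   | inj₁ uw = contradiction (conn-trans (sound c u∈) (conn-mono (λ ((k , _) , i) → k , i) uw)) ¬aw
      -- The exit edge `f` ends at `q` in `outer` but not in `inner`, so the previous stage can
      -- separate `p` from `q`.
      ...   | inj₂ (f , p , q , (cf , f-in) , jf , p∈ , q∉ , up , qw) with separable p∈ (inside⁻ jf f-in) q∉
      ...     | χ , agree , cp = recolour χ f (not c) , agree′ ,
                  exchange cp (keep (cf , f-in)) jf (outer⊆V (inner⊆outer p∈))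
                    (conn-mono (map₁ keep) up) (conn-mono (map₁ keep) qw)
        where
        keep : ∀ {e} → ClassIn outer c e → Class F χ c e
        keep ((e∈F , χe) , e-in) = e∈F , trans (agree e-in) χe
        agree′ : Agree inner (recolour χ f (not c))
        -- As `f` leaves `inner`, recolouring it changes nothing inside `inner`.
        agree′ e-in = trans (updateAt-minimal _ f χ λ { refl → q∉ (inside⁻ jf e-in) })
                            (agree (inside-mono inner⊆outer e-in))

    Saturated : Subset n → Set
    Saturated W = W ⊆ V × a ∈ W × (∀ c {u} → u ∈ W → Conn (ClassIn W c) a u)

    -- Each round either drops `b`, and then `separable` applies to `a` and `b`, or drops only other
    -- vertices and recurses on a strictly smaller set, or drops nothing.
    augment-from : ∀ {b outer inner} → Acc _⊂_ inner → Stage outer inner → b ∈ inner →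
      (∃ λ χ → Completable V F χ a b) ⊎ (∃ λ W → Saturated W × b ∈ W)
    augment-from {b} {outer} {inner} (acc rec) st b∈ with core inner (Stage.a∈inner st)
    ... | C , isCore@(_ , C⊆ , sound , _) with any? (λ u → (u ∈? inner) ×-dec ¬? (u ∈? C))
    -- Here `inner` is its own core, so `sound` connects it within itself in both colours.
    ...   | no none = inj₂ (inner , (outer⊆V ∘ inner⊆outer , a∈inner , λ c → sound c ∘ inner⊆C) , b∈)
      where
      open Stage st
      inner⊆C : inner ⊆ C
      inner⊆C {u} u∈ with u ∈? C
      ... | yes u∈C = u∈C
      ... | no u∉C = contradiction (u , u∈ , u∉C) none
    ...   | yes dropped with next-stage st isCore | b ∈? C
    ...     | st′ | yes b∈C = augment-from (rec (C⊆ , dropped)) st′ b∈C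
    ...     | st′ | no b∉C = inj₁ (map₂ proj₂ (Stage.separable st′ (Stage.a∈inner st′) b∈ b∉C))

    augment : ∀ {b} → b ∈ V → Completable V F χ₀ p q →
      (∃ λ χ → Completable V F χ a b) ⊎ (∃ λ W → Saturated W × b ∈ W)
    augment {b = b} b∈ cp with core V a∈V
    ... | C , isCore with first-stage cp isCore | b ∈? C
    ...   | st | yes b∈C = augment-from (⊂-wellFounded C) st b∈C
    ...   | st | no b∉C = inj₁ (map₂ proj₂ (Stage.separable st (Stage.a∈inner st) b∈ b∉C))

-- Deleting a vertex of degree 3

module _ {n m : ℕ} {G H : Graph n m} where

  private variable
    P : Fin m → Set
    e : Fin m
    u w : Fin n

  joins-transport : ends G e ≡ ends H e → Joins G e u w → Joins H e u w
  joins-transport eq = Sum.map (trans (sym eq)) (trans (sym eq))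

  conn-transport : (∀ {e} → P e → ends G e ≡ ends H e) → Conn G P u w → Conn H P u w
  conn-transport h refl = refl
  conn-transport h (step pe j c) = step pe (joins-transport (h pe) j) (conn-transport h c)

forest-transport : ∀ {n m} {G H : Graph n m} {P} → (∀ {e} → P e → ends G e ≡ ends H e) → Forest G P → Forest H P
forest-transport {G = G} {H} h forest pe j c =
  forest pe (joins-transport {G = H} {H = G} (sym (h pe)) j) (conn-transport (sym ∘ h ∘ proj₁) c)

-- Adding the redirected edge.

module _ {n m : ℕ} (G : Graph n m) (f : Fin m) (a b : Fin n) where

  redirect-ends : ends (redirect G f a b) f ≡ (a , b)
  redirect-ends with f ≟ f
  ... | yes _ = refl
  ... | no f≢f = contradiction refl f≢f

  redirect-ends-other : ∀ {e} → e ≢ f → ends G e ≡ ends (redirect G f a b) e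
  redirect-ends-other {e} e≢f with e ≟ f
  ... | yes e≡f = contradiction e≡f e≢f
  ... | no _ = refl

  -- The redirected `f` receives colour `not hue` and bridges the two components, one containing
  -- `a`, the other `b`. Edges of `F₀` keep their ends because `f` is not among them.
  redirect-twoTrees : ∀ {W F₀ F χ} → f ∉ F₀ → f ∈ F → F₀ ⊆ F → (∀ {e} → e ∈ F → e ≡ f ⊎ e ∈ F₀) →
    Completable G W F₀ χ a b → ∃ (TwoTrees (redirect G f a b) W F)
  redirect-twoTrees {W} {F₀} {F} {χ} f∉ f∈ F₀⊆F F⁻ cp = χ′ , record { connected = connected′ ; forest = forest′ }
    where
    open Completable cp
    H : Graph n m
    H = redirect G f a b
    χ′ : Colouring m
    χ′ = recolour χ f (not hue)
    same : ∀ {c e} → Class F₀ χ c e → ends G e ≡ ends H e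
    same (e∈ , _) = redirect-ends-other λ { refl → f∉ e∈ }
    extend : ∀ {c e} → Class F₀ χ c e → Class F χ′ c e
    extend (e∈ , χe) = recolour⁺ χ f (not hue) (F₀⊆F e∈ , χe) λ { refl → f∉ e∈ }
    restrict : ∀ {c e} → Class F χ′ c e → e ≡ f ⊎ Class F₀ χ c e
    restrict {e = e} k with e ≟ f | F⁻ (proj₁ k)
    ... | yes e≡f | _ = inj₁ e≡f
    ... | no e≢f | inj₁ e≡f = contradiction e≡f e≢f
    ... | no e≢f | inj₂ e∈ = inj₂ (e∈ , proj₂ (recolour⁻ χ f (not hue) k e≢f))
    restrict-hue : ∀ {e} → Class F χ′ hue e → Class F₀ χ hue e
    restrict-hue k = [ (λ e≡f → contradiction e≡f (recolour-other χ f (not hue) (≢-sym (not-¬ refl)) k)) , id ]′ (restrict k)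
    connected′ : ∀ c {u w} → u ∈ W → w ∈ W → Conn H (Class F χ′ c) u w
    connected′ c u∈ w∈ with c Bool.≟ hue
    ... | yes refl = conn-mono H extend (conn-transport same (connected u∈ w∈))
    ... | no c≢ with refl ← ¬-not c≢ =
      conn-add H (inj₁ redirect-ends) extend (f∈ , updateAt-updates f χ)
        (Sum.map (conn-transport same) (conn-transport same) ∘ covered) u∈ w∈
    forest′ : ∀ c → Forest H (Class F χ′ c)
    forest′ c with c Bool.≟ hue
    ... | yes refl = forest-mono H restrict-hue (forest-transport same (forest hue))
    ... | no c≢ with refl ← ¬-not c≢ =
      forest-add H (inj₁ redirect-ends) restrict (forest-transport same (forest (not hue)))
        (separated ∘ conn-transport (sym ∘ same))

-- The vertex `v` and its star.

module _ {n m : ℕ} (G : Graph n m) (v : Fin n) where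

  V-v : Subset n
  V-v = ∁ ⁅ v ⁆

  ∈V-v⁺ : ∀ {u} → u ≢ v → u ∈ V-v
  ∈V-v⁺ = x∉p⇒x∈∁p ∘ x≢y⇒x∉⁅y⁆

  ∈V-v⁻ : ∀ {u} → u ∈ V-v → u ≢ v
  ∈V-v⁻ = x∉⁅y⁆⇒x≢y ∘ x∈∁p⇒x∉p

  avoids-v? : Decidable (λ e → ¬ Incident G e v)
  avoids-v? e = ¬? (incident? G e v)

  E-v : Subset m
  E-v = subset avoids-v?

  E-v-inside : ∀ {e} → ¬ Incident G e v → Inside G V-v e
  E-v-inside ¬inc = ∈V-v⁺ (¬inc ∘ inj₁) , ∈V-v⁺ (¬inc ∘ inj₂)

  -- The three edges come in a chosen order, so that symmetric cases reduce to one by `star-swap`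
  -- and `star-rotate`.
  record Star (e₁ e₂ e₃ : Fin m) (x₁ x₂ x₃ : Fin n) : Set where
    constructor star
    field
      e₁≢e₂ : e₁ ≢ e₂
      e₁≢e₃ : e₁ ≢ e₃
      e₂≢e₃ : e₂ ≢ e₃
      joins₁ : Joins G e₁ v x₁
      joins₂ : Joins G e₂ v x₂
      joins₃ : Joins G e₃ v x₃
      only : ∀ e → Incident G e v → e ≡ e₁ ⊎ e ≡ e₂ ⊎ e ≡ e₃

  private variable
    e₁ e₂ e₃ : Fin m
    x₁ x₂ x₃ : Fin n

  star-swap : Star e₁ e₂ e₃ x₁ x₂ x₃ → Star e₁ e₃ e₂ x₁ x₃ x₂
  star-swap (star d₁ d₂ d₃ j₁ j₂ j₃ only) =
    star d₂ d₁ (≢-sym d₃) j₁ j₃ j₂ (λ e → Sum.map₂ swap ∘ only e)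

  star-rotate : Star e₁ e₂ e₃ x₁ x₂ x₃ → Star e₂ e₃ e₁ x₂ x₃ x₁
  star-rotate (star d₁ d₂ d₃ j₁ j₂ j₃ only) =
    star d₃ (≢-sym d₁) (≢-sym d₂) j₂ j₃ j₁ (λ e → [ inj₂ ∘ inj₂ , [ inj₁ , inj₂ ∘ inj₁ ]′ ]′ ∘ only e)

  module _ {χ : Colouring m} (tt : TwoTrees G ⊤ ⊤ χ) where
    open TwoTrees tt

    star-edge : ∀ c {u} → u ≢ v → ∃₂ λ e x → χ e ≡ c × Joins G e v x × Conn G (Class E-v χ c) u x
    star-edge c {u} u≢v with last-edge G v (connected c {u} {v} ∈⊤ ∈⊤)
    ... | inj₁ u≡v = contradiction u≡v u≢v
    ... | inj₂ (e , x , (_ , χe) , k , d) =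
      e , x , χe , k , conn-mono G (λ ((_ , χe) , ¬inc) → ∈-subset⁺ avoids-v? ¬inc , χe) d

    -- With `e₁` alone in its colour, `v` is a leaf of that tree and its removal leaves a tree. The
    -- other tree loses `v` between `x₂` and `x₃` and falls into their two components.
    delete-leaf : ∀ {c} → Star e₁ e₂ e₃ x₁ x₂ x₃ → χ e₁ ≡ c → χ e₂ ≡ not c → χ e₃ ≡ not c →
      Completable G V-v E-v χ x₂ x₃
    delete-leaf {e₁} {e₂} {e₃} {x₁} {x₂} {x₃} {c} (star d₁ d₂ d₃ j₁ j₂ j₃ only) χ₁ χ₂ χ₃ = record
        { hue = c
        ; connected = λ u∈ w∈ → conn-trans G (to-x₁ u∈) (conn-sym G (to-x₁ w∈))
        ; forest = λ d → forest-mono G (λ (_ , χe) → ∈⊤ , χe) (forest d)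
        -- A remaining connection between `x₂` and `x₃`, extended by `e₃`, would bypass `e₂`.
        ; separated = λ d → forest (not c) (∈⊤ , χ₂) j₂
            (conn-sym G (conn-trans G (conn-mono G keep d) (conn-edge G ((∈⊤ , χ₃) , ≢-sym d₃) (joins-sym G j₃))))
        ; covered = to-x₂₃ }
      where
      keep : ∀ {e} → Class E-v χ (not c) e → (Class ⊤ χ (not c) ∖ e₂) e
      keep (e∈ , χe) = (∈⊤ , χe) , λ { refl → ∈-subset⁻ avoids-v? e∈ (joins⇒incident G j₂) }
      to-x₁ : ∀ {u} → u ∈ V-v → Conn G (Class E-v χ c) u x₁
      to-x₁ u∈ with star-edge c (∈V-v⁻ u∈)
      ... | e , x , χe , k , d with only e (joins⇒incident G k)
      ...   | inj₁ refl = subst (Conn G _ _) (joins-other G k j₁) d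
      ...   | inj₂ (inj₁ refl) = contradiction χ₂ (not-¬ χe)
      ...   | inj₂ (inj₂ refl) = contradiction χ₃ (not-¬ χe)
      to-x₂₃ : ∀ {u} → u ∈ V-v → Conn G (Class E-v χ (not c)) u x₂ ⊎ Conn G (Class E-v χ (not c)) u x₃
      to-x₂₃ u∈ with star-edge (not c) (∈V-v⁻ u∈)
      ... | e , x , χe , k , d with only e (joins⇒incident G k)
      ...   | inj₁ refl = contradiction χe (not-¬ χ₁)
      ...   | inj₂ (inj₁ refl) = inj₁ (subst (Conn G _ _) (joins-other G k j₂) d)
      ...   | inj₂ (inj₂ refl) = inj₂ (subst (Conn G _ _) (joins-other G k j₃) d)

    -- The tree of the other colour must also reach `v`, and looplessness provides a vertex `x₁`
    -- other than `v` from which to reach it.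
    not-monochromatic : Loopless G → ∀ {c} → Star e₁ e₂ e₃ x₁ x₂ x₃ → χ e₁ ≡ c → χ e₂ ≡ c → χ e₃ ≡ c → ⊥
    not-monochromatic loopless {c} (star _ _ _ j₁ _ _ only) χ₁ χ₂ χ₃
      with star-edge (not c) (≢-sym (loopless-joins G loopless j₁))
    ... | e , _ , χe , k , _ with only e (joins⇒incident G k)
    ...   | inj₁ refl = not-¬ χ₁ χe
    ...   | inj₂ (inj₁ refl) = not-¬ χ₂ χe
    ...   | inj₂ (inj₂ refl) = not-¬ χ₃ χe

    -- Among three edges in two colours, not all alike, exactly one is alone in its colour; rotating
    -- the star brings it to the front.
    delete-vertex : Loopless G → Star e₁ e₂ e₃ x₁ x₂ x₃ → ∃₂ (Completable G V-v E-v χ)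
    delete-vertex {e₁} {e₂} {e₃} loopless st with χ e₂ Bool.≟ χ e₁ | χ e₃ Bool.≟ χ e₁
    ... | yes p | yes q = ⊥-elim (not-monochromatic loopless st refl p q)
    ... | no p | no q = _ , _ , delete-leaf st refl (¬-not p) (¬-not q)
    ... | yes p | no q = _ , _ , delete-leaf (star-rotate (star-rotate st)) refl
                           (¬-not (≢-sym q)) (trans p (¬-not (≢-sym q)))
    ... | no p | yes q = _ , _ , delete-leaf (star-rotate st) refl
                           (trans q (¬-not (≢-sym p))) (¬-not (≢-sym p))

  -- Two parallel edges with their ends form a bispanning subgraph, each edge being a tree. It has
  -- two vertices and omits `e₃`, so atomicity excludes it.
  neighbours-distinct : Loopless G → Atomic G → Star e₁ e₂ e₃ x₁ x₂ x₃ → x₁ ≢ x₂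
  neighbours-distinct {e₁} {e₂} {e₃} {x} loopless (_ , minimal) (star d₁ d₂ d₃ j₁ j₂ _ _) refl
    with minimal W F (twoTrees⇒bispanning G ((v , v∈) , ends∈) tt)
    where
    W : Subset n
    W = ⁅ v ⁆ ∪ ⁅ x ⁆
    F : Subset m
    F = ⁅ e₁ ⁆ ∪ ⁅ e₂ ⁆
    v∈ : v ∈ W
    v∈ = p⊆p∪q ⁅ x ⁆ (x∈⁅x⁆ v)
    F⁻ : ∀ {e} → e ∈ F → e ≡ e₁ ⊎ e ≡ e₂
    F⁻ = Sum.map (x∈⁅y⁆⇒x≡y e₁) (x∈⁅y⁆⇒x≡y e₂) ∘ x∈p∪q⁻ ⁅ e₁ ⁆ ⁅ e₂ ⁆
    ends∈ : ∀ e → e ∈ F → Inside G W e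
    ends∈ e e∈ = [ (λ { refl → inside⁺ G j₁ v∈ x∈ }) , (λ { refl → inside⁺ G j₂ v∈ x∈ }) ]′ (F⁻ e∈)
      where x∈ = q⊆p∪q ⁅ v ⁆ ⁅ x ⁆ (x∈⁅x⁆ x)
    χ : Colouring m
    χ e = does (e ≟ e₁)
    edge : ∀ c → ∃ λ e → Class F χ c e × Joins G e v x
    edge true = e₁ , (p⊆p∪q ⁅ e₂ ⁆ (x∈⁅x⁆ e₁) , dec-true (e₁ ≟ e₁) refl) , j₁
    edge false = e₂ , (q⊆p∪q ⁅ e₁ ⁆ ⁅ e₂ ⁆ (x∈⁅x⁆ e₂) , dec-false (e₂ ≟ e₁) (≢-sym d₁)) , j₂
    only-edge : ∀ c {e} → Class F χ c e → e ≡ proj₁ (edge c)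
    only-edge true {e} (e∈ , χe) with yes e≡e₁ ← e ≟ e₁ = e≡e₁
    only-edge false {e} (e∈ , χe) with no e≢e₁ ← e ≟ e₁ = [ (λ e≡e₁ → contradiction e≡e₁ e≢e₁) , id ]′ (F⁻ e∈)
    to-v : ∀ c {u} → u ∈ W → Conn G (Class F χ c) u v
    to-v c u∈ with x∈p∪q⁻ ⁅ v ⁆ ⁅ x ⁆ u∈
    ... | inj₁ u∈v with refl ← x∈⁅y⁆⇒x≡y v u∈v = refl
    ... | inj₂ u∈x with refl ← x∈⁅y⁆⇒x≡y x u∈x =
      let _ , k , j = edge c in conn-edge G k (joins-sym G j)
    bridge : ∀ c → Forest G (Class F χ c)
    bridge c k j refl = loopless-joins G loopless j refl
    bridge c k j (step (k′ , e≢) _ _) = e≢ (trans (only-edge c k′) (sym (only-edge c k)))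
    tt : TwoTrees G W F χ
    tt = record { connected = λ c u∈ w∈ → conn-trans G (to-v c u∈) (conn-sym G (to-v c w∈)) ; forest = bridge }
  ... | inj₂ ∣W∣≡1 = two-members (p⊆p∪q ⁅ x ⁆ (x∈⁅x⁆ v)) (q⊆p∪q ⁅ v ⁆ ⁅ x ⁆ (x∈⁅x⁆ x)) (loopless-joins G loopless j₁) ∣W∣≡1
  ... | inj₁ (_ , F≡⊤) = [ d₂ ∘ sym ∘ x∈⁅y⁆⇒x≡y e₁ , d₃ ∘ sym ∘ x∈⁅y⁆⇒x≡y e₂ ]′
          (x∈p∪q⁻ ⁅ e₁ ⁆ ⁅ e₂ ⁆ (subst (e₃ ∈_) (sym F≡⊤) ∈⊤))

  -- If augmentation fails, the saturated `W` with its edges is bispanning: both classes connect it,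
  -- and they are forests as parts of the trees of `G`. It omits `v` and contains the distinct
  -- vertices `a` and `b`, against atomicity.
  completable : Loopless G → Atomic G → Star e₁ e₂ e₃ x₁ x₂ x₃ → ∃ λ χ → Completable G V-v E-v χ x₁ x₂
  completable {x₁ = a} {x₂ = b} loopless atomic@(bispanning , minimal) st with bispanning⇒twoTrees G bispanning
  ... | χ , tt with delete-vertex tt loopless st
  ...   | _ , _ , cp with Augment.augment G V-v E-v χ (E-v-inside ∘ ∈-subset⁻ avoids-v?) a a∈ b∈ cp
    where
    a∈ = ∈V-v⁺ (≢-sym (loopless-joins G loopless (Star.joins₁ st)))
    b∈ = ∈V-v⁺ (≢-sym (loopless-joins G loopless (Star.joins₂ st)))
  ...     | inj₁ done = done
  ...     | inj₂ (W , (W⊆ , a∈W , linked) , b∈W) with minimal W F (twoTrees⇒bispanning G ((a , a∈W) , λ e → proj₂ ∘ F⁻) tt′)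
    where
    F? : Decidable (λ e → e ∈ E-v × Inside G W e)
    F? e = (e ∈? E-v) ×-dec inside? G W e
    F : Subset m
    F = subset F?
    F⁻ : ∀ {e} → e ∈ F → e ∈ E-v × Inside G W e
    F⁻ = ∈-subset⁻ F?
    from-a : ∀ c {u} → u ∈ W → Conn G (Class F χ c) a u
    from-a c = conn-mono G (λ ((e∈ , χe) , i) → ∈-subset⁺ F? (e∈ , i) , χe) ∘ linked c
    tt′ : TwoTrees G W F χ
    tt′ = record
      { connected = λ c u∈ w∈ → conn-trans G (conn-sym G (from-a c u∈)) (from-a c w∈)
      ; forest = λ c → forest-mono G (λ (_ , χe) → ∈⊤ , χe) (TwoTrees.forest tt c) }
  ...       | inj₁ (W≡⊤ , _) = contradiction refl (∈V-v⁻ (W⊆ (subst (v ∈_) (sym W≡⊤) ∈⊤)))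
  ...       | inj₂ ∣W∣≡1 = contradiction ∣W∣≡1 (two-members a∈W b∈W (neighbours-distinct loopless atomic st))

  -- The index `e₁` is reused for the new edge, so the edge set consists of `E-v` and `e₁`.
  redirect-bispanning : Loopless G → Atomic G → Star e₁ e₂ e₃ x₁ x₂ x₃ →
    BispanningSub (redirect G e₁ x₁ x₂) (∁ ⁅ v ⁆) (∁ (⁅ e₂ ⁆ ∪ ⁅ e₃ ⁆))
  redirect-bispanning {e₁} {e₂} {e₃} {x₁} {x₂} loopless atomic st@(star d₁ d₂ d₃ j₁ j₂ j₃ only) =
      twoTrees⇒bispanning H ((x₁ , x₁∈) , ends∈)
        (proj₂ (redirect-twoTrees G e₁ x₁ x₂ (λ e₁∈ → E-v⁻ e₁∈ (joins⇒incident G j₁)) (F⁺ d₁ d₂)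
          (λ e∈ → F⁺ (λ { refl → E-v⁻ e∈ (joins⇒incident G j₂) }) (λ { refl → E-v⁻ e∈ (joins⇒incident G j₃) }))
          F⁻ (proj₂ (completable loopless atomic st))))
    where
    H : Graph n m
    H = redirect G e₁ x₁ x₂
    F : Subset m
    F = ∁ (⁅ e₂ ⁆ ∪ ⁅ e₃ ⁆)
    E-v⁻ : ∀ {e} → e ∈ E-v → ¬ Incident G e v
    E-v⁻ = ∈-subset⁻ avoids-v?
    F⁺ : ∀ {e} → e ≢ e₂ → e ≢ e₃ → e ∈ F
    F⁺ e≢e₂ e≢e₃ = x∉p⇒x∈∁p ([ e≢e₂ ∘ x∈⁅y⁆⇒x≡y e₂ , e≢e₃ ∘ x∈⁅y⁆⇒x≡y e₃ ]′ ∘ x∈p∪q⁻ ⁅ e₂ ⁆ ⁅ e₃ ⁆)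
    F⁻ : ∀ {e} → e ∈ F → e ≡ e₁ ⊎ e ∈ E-v
    F⁻ {e} e∈ with incident? G e v
    ... | no ¬inc = inj₂ (∈-subset⁺ avoids-v? ¬inc)
    ... | yes inc with only e inc
    ...   | inj₁ e≡e₁ = inj₁ e≡e₁
    ...   | inj₂ (inj₁ refl) = contradiction (p⊆p∪q ⁅ e₃ ⁆ (x∈⁅x⁆ e₂)) (x∈∁p⇒x∉p e∈)
    ...   | inj₂ (inj₂ refl) = contradiction (q⊆p∪q ⁅ e₂ ⁆ ⁅ e₃ ⁆ (x∈⁅x⁆ e₃)) (x∈∁p⇒x∉p e∈)
    x₁∈ : x₁ ∈ V-v
    x₁∈ = ∈V-v⁺ (≢-sym (loopless-joins G loopless j₁))
    x₂∈ : x₂ ∈ V-v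
    x₂∈ = ∈V-v⁺ (≢-sym (loopless-joins G loopless j₂))
    ends∈ : ∀ e → e ∈ F → Inside H V-v e
    ends∈ e e∈ with e ≟ e₁ | F⁻ e∈
    ... | yes refl | _ = x₁∈ , x₂∈
    ... | no e≢e₁ | inj₁ e≡e₁ = contradiction e≡e₁ e≢e₁
    ... | no _ | inj₂ e∈E = E-v-inside (E-v⁻ e∈E)

mainTheorem16 : ∀ {n m : ℕ} (G : Graph n m) → Loopless G → Atomic G →
    (v x y z : Fin n) (ex ey ez : Fin m) →
    ex ≢ ey → ex ≢ ez → ey ≢ ez →
    Joins G ex v x → Joins G ey v y → Joins G ez v z →
    (∀ e → Incident G e v → e ≡ ex ⊎ e ≡ ey ⊎ e ≡ ez) →
    BispanningSub (redirect G ex x y) (∁ ⁅ v ⁆) (∁ (⁅ ey ⁆ ∪ ⁅ ez ⁆)) ×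
    BispanningSub (redirect G ex x z) (∁ ⁅ v ⁆) (∁ (⁅ ey ⁆ ∪ ⁅ ez ⁆)) ×
    BispanningSub (redirect G ey y z) (∁ ⁅ v ⁆) (∁ (⁅ ex ⁆ ∪ ⁅ ez ⁆))
mainTheorem16 G loopless atomic v x y z ex ey ez d₁ d₂ d₃ jx jy jz only =
    bispanning st
  -- The permuted stars list the two deleted edges in the opposite order.
  , subst (BispanningSub (redirect G ex x z) (∁ ⁅ v ⁆) ∘ ∁) (∪-comm ⁅ ez ⁆ ⁅ ey ⁆) (bispanning (star-swap G v st))
  , subst (BispanningSub (redirect G ey y z) (∁ ⁅ v ⁆) ∘ ∁) (∪-comm ⁅ ez ⁆ ⁅ ex ⁆) (bispanning (star-rotate G v st))
  where
  st : Star G v ex ey ez x y z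
  st = star d₁ d₂ d₃ jx jy jz only
  bispanning : ∀ {e₁ e₂ e₃ x₁ x₂ x₃} → Star G v e₁ e₂ e₃ x₁ x₂ x₃ →
    BispanningSub (redirect G e₁ x₁ x₂) (∁ ⁅ v ⁆) (∁ (⁅ e₂ ⁆ ∪ ⁅ e₃ ⁆))
  bispanning = redirect-bispanning G v loopless atomic
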